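{- Let $B$ and $B'$ be two $m$-level rook equivalent Ferrers boards and let $N$ be large enough that $B$ and $B'$ both fit inside $\mathrm{Sq}_{N,m}$. Then for any non-negative integer $k\le N$, there is an explicit bijection between $H^{(m)}_{k,N}(B)$ and $H^{(m)}_{k,N}(B')$.
   Context: Fix a positive integer $m$. For integers $0\le b_1\le b_2\le\dots\le b_n$, the Ferrers board $B=(b_1,\dots,b_n)$ is the set of cells $(i,j)$ of positive integers with $1\le i\le n$ and $j\le b_i$, where $(i,j)$ is the cell in column $i$ (counted from left to right) and row $j$ (counted from bottom to top). For $p\ge1$, the $p$th level of a board consists of its cells in rows $(p-1)m+1,\dots,pm$. An $m$-level rook placement of $k$ rooks on a board is a set of $k$ of its cells containing no more than one cell from any given level or column; $r_{k,m}(B)$ denotes the number of these on $B$. Two boards $B,B'$ are $m$-level rook equivalent if $r_{k,m}(B)=r_{k,m}(B')$ for all $k$. $\mathrm{Sq}_{N,m}$ is the rectangular board with $N$ columns and $mN$ rows. A board $B$ fits inside $\mathrm{Sq}_{N,m}$ if juxtaposing the two boards with their lower right cells in the same position makes the cells of $B$ a subset of the cells of $\mathrm{Sq}_{N,m}$; $B$ is then regarded as a subset of $\mathrm{Sq}_{N,m}$ in this way. Let $\alpha$ be a generator of the cyclic group $C_m$, so that the wreath product of $C_m$ with the symmetric group $S_N$ is $C_m\wr S_N=\{(\alpha^{s_1},\dots,\alpha^{s_N};\sigma)\mid 1\le s_i\le m \text{ for each } i,\ \sigma\in S_N\}$. For $\omega=(\alpha^{s_1},\dots,\alpha^{s_N};\sigma)$,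 $R(\omega)$ is the rook placement on $\mathrm{Sq}_{N,m}$ having, for each column $i$, a rook in column $i$ and level $N+1-\sigma(i)$, in the $s_i$-th cell from the bottom of that level. The $k$th hit set of $B$ is $H^{(m)}_{k,N}(B)=\{R(\omega)\mid \omega\in C_m\wr S_N \text{ and } \#(R(\omega)\cap B)=k\}$. -}

module Defs where

open import Data.Fin.Base as Fin using (Fin; toℕ)
open import Data.Fin.Permutation using (Permutation′; _⟨$⟩ʳ_)
open import Data.List.Base using (List; []; _∷_; _++_; map; concatMap; filter; length; upTo; allFin)
open import Data.List.Relation.Binary.Subset.Propositional using (_⊆_)
open import Data.List.Relation.Unary.AllPairs using (AllPairs; allPairs?)
open import Data.Nat.Base using (ℕ; suc; _+_; _*_; _∸_; _≤_; NonZero)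
open import Data.Nat.DivMod using (_/_)
open import Data.Nat.Properties using (_≟_; ≤-refl)
open import Data.Product.Base using (_×_; _,_; proj₁; proj₂; ∃-syntax)
open import Data.Product.Properties using (≡-dec)
open import Level using (0ℓ)
open import Relation.Binary.Bundles using (Setoid)
open import Relation.Binary.Definitions using (DecidableEquality)
import Relation.Binary.Construct.On as On
open import Relation.Binary.PropositionalEquality using (_≡_; _≢_; setoid)
open import Relation.Nullary.Decidable using (Dec; ¬?; _×-dec_)

-- (i , j) is the cell in column i and row j, both counted from 1.
Cell : Set
Cell = ℕ × ℕ

column row : Cell → ℕ
column = proj₁
row    = proj₂

_≟ᶜ_ : DecidableEquality Cell
_≟ᶜ_ = ≡-dec _≟_ _≟_

open import Data.List.Membership.DecPropositional _≟ᶜ_ using (_∈?_)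

-- Finite sets of cells are duplicate-free lists in lexicographic order, so that
-- equality of sets is propositional equality of lists and cardinality is length.
CellSet : Set
CellSet = List Cell

infixr 7 _∩_
_∩_ : CellSet → CellSet → CellSet
P ∩ Q = filter (_∈? Q) P

-- Applied to a duplicate-free list, every subset appears exactly once.
subsets : ∀ {A : Set} → List A → List (List A)
subsets []       = [] ∷ []
subsets (x ∷ xs) = map (x ∷_) (subsets xs) ++ subsets xs

-- b i is the height b_{i+1} of column i+1, as Fin n counts from 0.
record FerrersBoard : Set where
  field
    n    : ℕ
    b    : Fin n → ℕ
    mono : ∀ {i j} → i Fin.≤ j → b i ≤ b j

open FerrersBoard

cells : FerrersBoard → CellSet
cells B = concatMap (λ i → map (λ j → suc (toℕ i) , suc j) (upTo (b B i))) (allFin (n B))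

-- The p ≥ 1 with (p - 1) m + 1 ≤ row c ≤ p m, for c in a row ≥ 1.
level : (m : ℕ) .{{_ : NonZero m}} → Cell → ℕ
level m c = suc ((row c ∸ 1) / m)

NonAttacking : (m : ℕ) .{{_ : NonZero m}} → Cell → Cell → Set
NonAttacking m c d = column c ≢ column d × level m c ≢ level m d

IsPlacement : (m : ℕ) .{{_ : NonZero m}} → ℕ → CellSet → Set
IsPlacement m k P = length P ≡ k × AllPairs (NonAttacking m) P

isPlacement? : (m : ℕ) .{{_ : NonZero m}} (k : ℕ) (P : CellSet) → Dec (IsPlacement m k P)
isPlacement? m k P =
  length P ≟ k ×-dec
  allPairs? (λ c d → ¬? (column c ≟ column d) ×-dec ¬? (level m c ≟ level m d)) P

rookNumber : (m : ℕ) .{{_ : NonZero m}} → ℕ → FerrersBoard → ℕ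
rookNumber m k B = length (filter (isPlacement? m k) (subsets (cells B)))

RookEquivalent : (m : ℕ) .{{_ : NonZero m}} → FerrersBoard → FerrersBoard → Set
RookEquivalent m B B′ = ∀ k → rookNumber m k B ≡ rookNumber m k B′

Sq : (N m : ℕ) → FerrersBoard
Sq N m = record { n = N ; b = λ _ → m * N ; mono = λ _ → ≤-refl }

-- The cells of B after moving its rightmost column n to column N.  A cell pushed
-- off the left edge of Sq N m is sent to column 0, which is not a column of Sq N m,
-- so truncated subtraction does not make FitsInside hold wrongly.  Leading columns
-- of height 0 contain no cells, hence n B ≤ N is not required.
aligned : ℕ → FerrersBoard → CellSet
aligned N B = map (λ (i , j) → (i + N) ∸ n B , j) (cells B)

FitsInside : FerrersBoard → (N m : ℕ) → Set
FitsInside B N m = aligned N B ⊆ cells (Sq N m)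

-- The underlying set of C_m ≀ S_N: a generator's power α^s with 1 ≤ s ≤ m is
-- recorded by s - 1 : Fin m, and S_N acts on Fin N, i.e. on {0,…,N-1}.
Wreath : (m N : ℕ) → Set
Wreath m N = (Fin N → Fin m) × Permutation′ N

-- The row of the s-th cell from the bottom of level p.
rowInLevel : (m p s : ℕ) → ℕ
rowInLevel m p s = (p ∸ 1) * m + s

R : ∀ {m N} → Wreath m N → CellSet
R {m} {N} (s , σ) =
  map (λ i → suc (toℕ i) , rowInLevel m (N + 1 ∸ suc (toℕ (σ ⟨$⟩ʳ i))) (suc (toℕ (s i))))
      (allFin N)

-- A setoid, because the witness ω is not part of the identity of the placement P.
HitSet : (m N k : ℕ) → FerrersBoard → Setoid 0ℓ 0ℓ
HitSet m N k B = On.setoid {B = Hit} (setoid CellSet) proj₁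
  where
  Hit : Set
  Hit = ∃[ P ] ∃[ ω ] (P ≡ R {m} {N} ω × length (R ω ∩ aligned N B) ≡ k)

{-# OPTIONS --safe #-}
module Submission where

-- Regard the k-th binomial moment of the hit counts, the sum of
-- C(|P ∩ B|, k) over all full placements P = R(ω), as the number of pairs S ⊆ P ∩ B with |S| = k.
-- Only non-attacking S contribute, and each such S lies in the same number of full placements:
-- deleting the columns and levels of S leaves a square with N - k columns and N - k levels.
-- Hence the moment is r_{k,m}(B) times a number depending on N, k and m only, and since the
-- moments determine the distribution of the hit counts, rook equivalent boards have hit sets of
-- equal size.  The bijection matches the hit sets in the order in which they are enumerated.

open import Defs
open import Data.Bool.Base using (if_then_else_; true; false)
open import Data.Fin.Base using (Fin; zero; suc; toℕ; opposite; cast; fromℕ<; punchOut)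
import Data.Fin.Properties as Finₚ
open import Data.Fin.Permutation using (Permutation′; permutation; _⟨$⟩ʳ_)
open import Data.List.Base hiding (sum)
open import Data.List.Properties hiding (sum-++)
open import Data.List.Membership.Propositional using (_∈_; _∉_)
open import Data.List.Membership.Propositional.Properties
open import Data.List.Membership.DecPropositional _≟ᶜ_ using (_∈?_)
open import Data.List.Membership.Propositional.Properties.WithK using (unique∧set⇒bag)
open import Data.List.Relation.Binary.BagAndSetEquality using (∼bag⇒↭)
open import Data.List.Relation.Binary.Permutation.Propositional using (_↭_; refl; prep; swap; ↭-sym; ↭⇒↭ₛ)
import Data.List.Relation.Binary.Permutation.Propositional.Properties as Perm
open import Data.List.Relation.Binary.Pointwise.Base using (Pointwise; []; _∷_)
open import Data.List.Relation.Binary.Subset.Propositional using (_⊆_)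
open import Data.List.Relation.Unary.All as All using (All; []; _∷_; all?)
import Data.List.Relation.Unary.All.Properties as All
open import Data.List.Relation.Unary.AllPairs as AllPairs using (AllPairs; []; _∷_; allPairs?)
import Data.List.Relation.Unary.AllPairs.Properties as AllPairs
open import Data.List.Relation.Unary.Any using (here; there; index; satisfied)
open import Data.List.Relation.Unary.Any.Properties using (lookup-index)
open import Data.List.Relation.Unary.Unique.Propositional using (Unique)
import Data.List.Relation.Unary.Unique.Propositional.Properties as Unique
open import Data.Nat.Base hiding (_/_; _%_)
open import Data.Nat.Combinatorics using (_C_; nCn≡1; k>n⇒nCk≡0; nCk+nC[k+1]≡[n+1]C[k+1])
open import Data.Nat.DivMod
open import Data.Nat.Divisibility using (n∣m*n)
open import Data.Nat.ListAction using (sum)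
open import Data.Nat.ListAction.Properties using (sum-++)
open import Data.Nat.Properties
open import Algebra.Properties.CommutativeSemigroup +-commutativeSemigroup using (interchange; x∙yz≈y∙xz)
open import Data.Product.Base using (_×_; _,_; proj₁; proj₂; Σ-syntax; ∃-syntax)
open import Data.Sum.Base using (_⊎_; inj₁; inj₂)
open import Data.Unit.Base using (tt)
open import Function.Base using (_∘_; id)
open import Function.Bundles using (Bijection; Injection; mk⇔)
open import Function.Properties.Inverse using (↔⇒↣)
open import Level using (0ℓ)
open import Relation.Binary.Bundles using (Setoid)
open import Relation.Binary.Core using (Rel)
open import Relation.Binary.Definitions using (DecidableEquality; Symmetric) renaming (Decidable to Decidable₂)
open import Relation.Binary.PropositionalEquality
open import Relation.Nullary using (Dec; yes; no; ¬_; does; contradiction)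
open import Relation.Nullary.Decidable using (¬?; _×-dec_; dec-true; dec-false)
open import Relation.Unary using (Decidable)

-- Equivalent boards can have different shapes, and no symmetry of the square need carry one to the
-- other, so only counts can be compared. Counting pairs `(S , P)` replaces the condition of exactly
-- k hits by containment of `S`, and the number of `P` around a fixed `S` does not see the board.
-- The passage back from moments to counts is triangular, so it is carried out from the largest hit
-- count downwards, without signed sums. Two points of form matter. Sets are lists, so the square is
-- enumerated column by column; every `R ω` is then literally one of its sublists, not merely a
-- reordering of one. And deleting the columns and levels of `S` leaves gaps, so the count runs over
-- grids on arbitrary lists of columns and levels, which are relabelled only when no rook of `S` is
-- left.

private variable
  A B D : Set
  P Q : Set

-- Finite sums and indicators

∑ : (A → ℕ) → List A → ℕ
∑ f xs = sum (map f xs)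

-- The Iverson bracket. It looks only at `does d`, so it ignores which proof the decision carries.
⟦_⟧ : Dec P → ℕ
⟦ d ⟧ = if does d then 1 else 0

⟦⟧-yes : (d : Dec P) → P → ⟦ d ⟧ ≡ 1
⟦⟧-yes d p = cong (if_then 1 else 0) (dec-true d p)

⟦⟧-no : (d : Dec P) → ¬ P → ⟦ d ⟧ ≡ 0
⟦⟧-no d ¬p = cong (if_then 1 else 0) (dec-false d ¬p)

⟦⟧-cong : (d : Dec P) (e : Dec Q) → (P → Q) → (Q → P) → ⟦ d ⟧ ≡ ⟦ e ⟧
⟦⟧-cong (yes p) e f g = sym (⟦⟧-yes e (f p))
⟦⟧-cong (no ¬p) e f g = sym (⟦⟧-no e (¬p ∘ g))

⟦⟧-× : (d : Dec P) (e : Dec Q) → ⟦ d ×-dec e ⟧ ≡ ⟦ d ⟧ * ⟦ e ⟧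
⟦⟧-× (yes p) (yes q) = refl
⟦⟧-× (yes p) (no ¬q) = refl
⟦⟧-× (no ¬p) e       = refl

∑-cong-∈ : {f g : A → ℕ} (xs : List A) → (∀ {x} → x ∈ xs → f x ≡ g x) → ∑ f xs ≡ ∑ g xs
∑-cong-∈ []       eq = refl
∑-cong-∈ (x ∷ xs) eq = cong₂ _+_ (eq (here refl)) (∑-cong-∈ xs (eq ∘ there))

∑-cong : {f g : A → ℕ} (xs : List A) → (∀ x → f x ≡ g x) → ∑ f xs ≡ ∑ g xs
∑-cong xs eq = ∑-cong-∈ xs (λ {x} _ → eq x)

∑-zero : {f : A → ℕ} (xs : List A) → (∀ {x} → x ∈ xs → f x ≡ 0) → ∑ f xs ≡ 0
∑-zero []       eq = refl
∑-zero (x ∷ xs) eq = cong₂ _+_ (eq (here refl)) (∑-zero xs (eq ∘ there))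

∑-++ : (f : A → ℕ) (xs ys : List A) → ∑ f (xs ++ ys) ≡ ∑ f xs + ∑ f ys
∑-++ f xs ys = trans (cong sum (map-++ f xs ys)) (sum-++ (map f xs) (map f ys))

∑-map : (f : B → ℕ) (g : A → B) (xs : List A) → ∑ f (map g xs) ≡ ∑ (f ∘ g) xs
∑-map f g xs = cong sum (sym (map-∘ xs))

∑-distrib-+ : (f g : A → ℕ) (xs : List A) → ∑ (λ x → f x + g x) xs ≡ ∑ f xs + ∑ g xs
∑-distrib-+ f g []       = refl
∑-distrib-+ f g (x ∷ xs) =
  trans (cong (f x + g x +_) (∑-distrib-+ f g xs)) (interchange (f x) (g x) (∑ f xs) (∑ g xs))

∑-comm : (f : A → B → ℕ) (xs : List A) (ys : List B) →
         ∑ (λ x → ∑ (f x) ys) xs ≡ ∑ (λ y → ∑ (λ x → f x y) xs) ys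
∑-comm f []       ys = sym (∑-zero ys (λ _ → refl))
∑-comm f (x ∷ xs) ys =
  trans (cong (∑ (f x) ys +_) (∑-comm f xs ys)) (sym (∑-distrib-+ (f x) _ ys))

∑-*ˡ : (c : ℕ) (f : A → ℕ) (xs : List A) → ∑ (λ x → c * f x) xs ≡ c * ∑ f xs
∑-*ˡ c f []       = sym (*-zeroʳ c)
∑-*ˡ c f (x ∷ xs) = trans (cong (c * f x +_) (∑-*ˡ c f xs)) (sym (*-distribˡ-+ c (f x) _))

length-filter≡∑ : {P : A → Set} (P? : Decidable P) (xs : List A) →
                  length (filter P? xs) ≡ ∑ (λ x → ⟦ P? x ⟧) xs
length-filter≡∑ P? []       = refl
length-filter≡∑ P? (x ∷ xs) with does (P? x)
... | true  = cong suc (length-filter≡∑ P? xs)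
... | false = length-filter≡∑ P? xs

∑-filter : {P : A → Set} (P? : Decidable P) (f : A → ℕ) (xs : List A) →
           ∑ f (filter P? xs) ≡ ∑ (λ x → ⟦ P? x ⟧ * f x) xs
∑-filter P? f []       = refl
∑-filter P? f (x ∷ xs) with does (P? x)
... | true  = cong₂ _+_ (sym (*-identityˡ (f x))) (∑-filter P? f xs)
... | false = ∑-filter P? f xs

-- Sums over the subsets of a list

∈-subsets⇒⊆ : (X : List A) {S : List A} → S ∈ subsets X → S ⊆ X
∈-subsets⇒⊆ []      (here refl) ()
∈-subsets⇒⊆ (x ∷ X) S∈ y∈ with ∈-++⁻ (map (x ∷_) (subsets X)) S∈
... | inj₂ S∈′ = there (∈-subsets⇒⊆ X S∈′ y∈)
... | inj₁ S∈′ with ∈-map⁻ (x ∷_) S∈′ | y∈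
...   | _ , T∈ , refl | here eq  = here eq
...   | _ , T∈ , refl | there y∈ = there (∈-subsets⇒⊆ X T∈ y∈)

AllPairs-subset : {R : Rel A 0ℓ} (X : List A) {S : List A} → S ∈ subsets X → AllPairs R X → AllPairs R S
AllPairs-subset []      (here refl) _ = []
AllPairs-subset (x ∷ X) S∈ (x~X ∷ X~) with ∈-++⁻ (map (x ∷_) (subsets X)) S∈
... | inj₂ S∈′ = AllPairs-subset X S∈′ X~
... | inj₁ S∈′ with ∈-map⁻ (x ∷_) S∈′
...   | _ , T∈ , refl = All.tabulate (All.lookup x~X ∘ ∈-subsets⇒⊆ X T∈) ∷ AllPairs-subset X T∈ X~

subsets-unique : {X : List A} → Unique X → Unique (subsets X)
subsets-unique []             = [] ∷ []
subsets-unique {X = x ∷ X} (x∉X ∷ X!) =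
  Unique.++⁺ (Unique.map⁺ ∷-injectiveʳ (subsets-unique X!)) (subsets-unique X!) disjoint
  where
  disjoint : ∀ {S} → ¬ (S ∈ map (x ∷_) (subsets X) × S ∈ subsets X)
  disjoint (S∈ , S∈′) with ∈-map⁻ (x ∷_) S∈
  ... | _ , _ , refl = All.lookup x∉X (∈-subsets⇒⊆ X S∈′ (here refl)) refl

subsets-map : (f : A → B) (X : List A) → subsets (map f X) ≡ map (map f) (subsets X)
subsets-map f []      = refl
subsets-map f (x ∷ X) = begin
  map (f x ∷_) (subsets (map f X)) ++ subsets (map f X)
    ≡⟨ cong (λ s → map (f x ∷_) s ++ s) (subsets-map f X) ⟩
  map (f x ∷_) (map (map f) (subsets X)) ++ map (map f) (subsets X)
    ≡⟨ cong (_++ _) (trans (sym (map-∘ (subsets X))) (map-∘ (subsets X))) ⟩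
  map (map f) (map (x ∷_) (subsets X)) ++ map (map f) (subsets X)
    ≡⟨ map-++ (map f) (map (x ∷_) (subsets X)) (subsets X) ⟨
  map (map f) (subsets (x ∷ X)) ∎
  where open ≡-Reasoning

∑-subsets-∷ : (f : List A → ℕ) (x : A) (X : List A) →
              ∑ f (subsets (x ∷ X)) ≡ ∑ (f ∘ (x ∷_)) (subsets X) + ∑ f (subsets X)
∑-subsets-∷ f x X = trans (∑-++ f (map (x ∷_) (subsets X)) (subsets X)) (cong (_+ _) (∑-map f (x ∷_) (subsets X)))

-- A subset containing a rejected element contributes 0, so that element can be deleted from the
-- ground list. This is how attacked cells leave the board.
∑-subsets-filter : {Q : A → Set} (Q? : Decidable Q) (f : List A → ℕ) →
                   (∀ S → ¬ All Q S → f S ≡ 0) → (X : List A) →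
                   ∑ f (subsets X) ≡ ∑ f (subsets (filter Q? X))
∑-subsets-filter Q? f supp []      = refl
∑-subsets-filter Q? f supp (x ∷ X) with Q? x
... | yes q = begin
  ∑ f (subsets (x ∷ X))                                      ≡⟨ ∑-subsets-∷ f x X ⟩
  ∑ (f ∘ (x ∷_)) (subsets X) + ∑ f (subsets X)
    ≡⟨ cong₂ _+_ (∑-subsets-filter Q? (f ∘ (x ∷_)) (λ S ¬S → supp (x ∷ S) (¬S ∘ All.tail)) X)
                 (∑-subsets-filter Q? f supp X) ⟩
  ∑ (f ∘ (x ∷_)) (subsets (filter Q? X)) + ∑ f (subsets (filter Q? X))
    ≡⟨ ∑-subsets-∷ f x (filter Q? X) ⟨
  ∑ f (subsets (x ∷ filter Q? X)) ∎
  where open ≡-Reasoning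
... | no ¬q = begin
  ∑ f (subsets (x ∷ X))                         ≡⟨ ∑-subsets-∷ f x X ⟩
  ∑ (f ∘ (x ∷_)) (subsets X) + ∑ f (subsets X)
    ≡⟨ cong₂ _+_ (∑-zero (subsets X) (λ {S} _ → supp (x ∷ S) (¬q ∘ All.head)))
                 (∑-subsets-filter Q? f supp X) ⟩
  ∑ f (subsets (filter Q? X)) ∎
  where open ≡-Reasoning

-- Only sets through `x` count, and each is `x` together with a rest. Invariance under `↭` is
-- required because `x` may lie deep inside `X` while the right side puts it in front. Rests that
-- still contain `x` contribute 0 by the last hypothesis, so `X` need not be shortened.
∑-subsets-through : {x : A} {X : List A} → Unique X → x ∈ X → (f : List A → ℕ) →
                    (∀ {S T} → S ↭ T → f S ≡ f T) →
                    (∀ S → x ∉ S → f S ≡ 0) → (∀ S → x ∈ S → f (x ∷ S) ≡ 0) →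
                    ∑ f (subsets X) ≡ ∑ (f ∘ (x ∷_)) (subsets X)
∑-subsets-through {X = x ∷ X} (x≢ ∷ X!) (here refl) f f-↭ f∉ f∈ = begin
  ∑ f (subsets (x ∷ X))                                ≡⟨ ∑-subsets-∷ f x X ⟩
  ∑ (f ∘ (x ∷_)) (subsets X) + ∑ f (subsets X)
    ≡⟨ cong (∑ (f ∘ (x ∷_)) (subsets X) +_) (∑-zero (subsets X) λ S∈ → f∉ _ λ x∈ →
         All.lookup x≢ (∈-subsets⇒⊆ X S∈ x∈) refl) ⟩
  ∑ (f ∘ (x ∷_)) (subsets X) + 0                       ≡⟨ +-comm _ 0 ⟩
  ∑ (f ∘ (x ∷_)) (subsets X)
    -- A vanishing sum, in which `x` occurs twice, completes the range to all subsets of `x ∷ X`.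
    ≡⟨ cong (_+ ∑ (f ∘ (x ∷_)) (subsets X)) (∑-zero (subsets X) λ {S} _ → f∈ (x ∷ S) (here refl)) ⟨
  ∑ (f ∘ (x ∷_) ∘ (x ∷_)) (subsets X) + ∑ (f ∘ (x ∷_)) (subsets X)
    ≡⟨ ∑-subsets-∷ (f ∘ (x ∷_)) x X ⟨
  ∑ (f ∘ (x ∷_)) (subsets (x ∷ X)) ∎
  where open ≡-Reasoning
∑-subsets-through {x = x} {X = y ∷ X} (y≢ ∷ X!) (there x∈X) f f-↭ f∉ f∈ = begin
  ∑ f (subsets (y ∷ X))                                ≡⟨ ∑-subsets-∷ f y X ⟩
  ∑ (f ∘ (y ∷_)) (subsets X) + ∑ f (subsets X)
    ≡⟨ cong₂ _+_
         (∑-subsets-through X! x∈X (f ∘ (y ∷_)) (f-↭ ∘ prep y)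
           (λ S x∉S → f∉ (y ∷ S) λ { (here x≡y) → x≢y x≡y ; (there x∈S) → x∉S x∈S })
           (λ S x∈S → trans (f-↭ (swap y x refl)) (f∈ (y ∷ S) (there x∈S))))
         (∑-subsets-through X! x∈X f f-↭ f∉ f∈) ⟩
  ∑ (f ∘ (y ∷_) ∘ (x ∷_)) (subsets X) + ∑ (f ∘ (x ∷_)) (subsets X)
    ≡⟨ cong (_+ _) (∑-cong (subsets X) λ S → f-↭ (swap y x refl)) ⟩
  ∑ (f ∘ (x ∷_) ∘ (y ∷_)) (subsets X) + ∑ (f ∘ (x ∷_)) (subsets X)
    ≡⟨ ∑-subsets-∷ (f ∘ (x ∷_)) y X ⟨
  ∑ (f ∘ (x ∷_)) (subsets (y ∷ X)) ∎
  where
  open ≡-Reasoning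
  x≢y : x ≢ y
  x≢y refl = All.lookup y≢ x∈X refl

count-k-subsets : (k : ℕ) (X : List A) → ∑ (λ S → ⟦ length S ≟ k ⟧) (subsets X) ≡ length X C k
count-k-subsets zero    []      = refl
count-k-subsets (suc k) []      = refl
count-k-subsets k       (x ∷ X) = trans (∑-subsets-∷ (λ S → ⟦ length S ≟ k ⟧) x X) (pascal k)
  where
  open ≡-Reasoning
  pascal : ∀ k → ∑ (λ S → ⟦ length (x ∷ S) ≟ k ⟧) (subsets X) + ∑ (λ S → ⟦ length S ≟ k ⟧) (subsets X)
                 ≡ suc (length X) C k
  pascal zero    = cong₂ _+_ (∑-zero (subsets X) (λ _ → refl)) (count-k-subsets 0 X)
  pascal (suc k) = begin
    ∑ (λ S → ⟦ suc (length S) ≟ suc k ⟧) (subsets X) + ∑ (λ S → ⟦ length S ≟ suc k ⟧) (subsets X)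
      ≡⟨ cong₂ _+_
           (trans (∑-cong (subsets X) λ S → ⟦⟧-cong (suc (length S) ≟ suc k) (length S ≟ k) suc-injective (cong suc))
                  (count-k-subsets k X))
           (count-k-subsets (suc k) X) ⟩
    length X C k + length X C suc k ≡⟨ nCk+nC[k+1]≡[n+1]C[k+1] (length X) k ⟩
    suc (length X) C suc k ∎

-- Independent sets and their extensions

AllPairs-map-∈ : {R T : Rel A 0ℓ} {xs : List A} →
                 (∀ {x y} → x ∈ xs → y ∈ xs → R x y → T x y) → AllPairs R xs → AllPairs T xs
AllPairs-map-∈ f []         = []
AllPairs-map-∈ f (x~ ∷ xs~) =
  All.tabulate (λ y∈ → f (here refl) (there y∈) (All.lookup x~ y∈)) ∷
  AllPairs-map-∈ (λ x∈ y∈ → f (there x∈) (there y∈)) xs~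

AllPairs-lookup : {R : Rel A 0ℓ} {xs : List A} → Symmetric R → AllPairs R xs →
                  ∀ {x y} → x ∈ xs → y ∈ xs → x ≢ y → R x y
AllPairs-lookup ~-sym (x~ ∷ xs~) (here refl) (here refl) x≢y = contradiction refl x≢y
AllPairs-lookup ~-sym (x~ ∷ xs~) (here refl) (there y∈)  x≢y = All.lookup x~ y∈
AllPairs-lookup ~-sym (x~ ∷ xs~) (there x∈)  (here refl) x≢y = ~-sym (All.lookup x~ x∈)
AllPairs-lookup ~-sym (x~ ∷ xs~) (there x∈)  (there y∈)  x≢y = AllPairs-lookup ~-sym xs~ x∈ y∈ x≢y

-- For `NonAttacking m` this unfolds to `IsPlacement m`, and `#independent` on the cells of a board
-- to `rookNumber`. The relation is kept abstract so that counts can be moved to coordinates in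
-- which the board has disappeared.
Independent : Rel A 0ℓ → ℕ → List A → Set
Independent R n S = length S ≡ n × AllPairs R S

independent? : {R : Rel A 0ℓ} → Decidable₂ R → ∀ n → Decidable (Independent R n)
independent? R? n S = length S ≟ n ×-dec allPairs? R? S

#independent : {R : Rel A 0ℓ} → Decidable₂ R → ℕ → List A → ℕ
#independent R? n X = length (filter (independent? R? n) (subsets X))

-- Sublists of `map f X` match sublists of `X` position by position. The relation is compared on
-- members of `X` only, because the shift of a board into the square is faithful on its cells but
-- truncates elsewhere.
#independent-map : {R : Rel A 0ℓ} {T : Rel B 0ℓ} (R? : Decidable₂ R) (T? : Decidable₂ T)
                   (f : A → B) (X : List A) →
                   (∀ {x y} → x ∈ X → y ∈ X → R x y → T (f x) (f y)) →
                   (∀ {x y} → x ∈ X → y ∈ X → T (f x) (f y) → R x y) →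
                   ∀ n → #independent T? n (map f X) ≡ #independent R? n X
#independent-map R? T? f X to from n = begin
  #independent T? n (map f X)                                 ≡⟨ length-filter≡∑ (independent? T? n) (subsets (map f X)) ⟩
  ∑ (λ S → ⟦ independent? T? n S ⟧) (subsets (map f X))       ≡⟨ cong (∑ _) (subsets-map f X) ⟩
  ∑ (λ S → ⟦ independent? T? n S ⟧) (map (map f) (subsets X)) ≡⟨ ∑-map _ (map f) (subsets X) ⟩
  ∑ (λ S → ⟦ independent? T? n (map f S) ⟧) (subsets X)
    ≡⟨ ∑-cong-∈ (subsets X) (λ {S} S∈ → let S⊆X = ∈-subsets⇒⊆ X S∈ in
         ⟦⟧-cong (independent? T? n (map f S)) (independent? R? n S)
           (λ (len , fS~) → trans (sym (length-map f S)) len ,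
              AllPairs-map-∈ (λ x∈ y∈ → from (S⊆X x∈) (S⊆X y∈)) (AllPairs.map⁻ fS~))
           (λ (len , S~) → trans (length-map f S) len ,
              AllPairs.map⁺ (AllPairs-map-∈ (λ x∈ y∈ → to (S⊆X x∈) (S⊆X y∈)) S~))) ⟩
  ∑ (λ S → ⟦ independent? R? n S ⟧) (subsets X)               ≡⟨ length-filter≡∑ (independent? R? n) (subsets X) ⟨
  #independent R? n X ∎
  where open ≡-Reasoning

module Extensions {A : Set} (_≟ᴬ_ : DecidableEquality A) {R : Rel A 0ℓ} (R? : Decidable₂ R)
         (R-sym : Symmetric R) (R-irrefl : ∀ {x} → ¬ R x x) where

  open import Data.List.Membership.DecPropositional _≟ᴬ_ using () renaming (_∈?_ to _∈ᴬ?_)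
  open import Data.List.Relation.Binary.Permutation.Setoid.Properties (setoid A) using (AllPairs-resp-↭)

  #extensions : ℕ → List A → List A → ℕ
  #extensions n S X = ∑ (λ T → ⟦ independent? R? n T ×-dec all? (_∈ᴬ? T) S ⟧) (subsets X)

  #extensions-[] : ∀ n X → #extensions n [] X ≡ #independent R? n X
  #extensions-[] n X = trans
    (∑-cong (subsets X) λ T →
      ⟦⟧-cong (independent? R? n T ×-dec all? (_∈ᴬ? T) []) (independent? R? n T) proj₁ (_, []))
    (sym (length-filter≡∑ (independent? R? n) (subsets X)))

  -- An extension through `x` is determined by its other elements, all of which are related to `x`.
  -- Irreflexivity removes `x` itself from the supply, and the rest of `S` survives since `x` is
  -- related to it.
  #extensions-∷ : ∀ {n x S X} → Unique X → x ∈ X → All (R x) S →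
                  #extensions (suc n) (x ∷ S) X ≡ #extensions n S (filter (R? x) X)
  #extensions-∷ {n} {x} {S} {X} X! x∈X x~S = begin
    ∑ f (subsets X)
      ≡⟨ ∑-subsets-through X! x∈X f
           (λ {T} {T′} T↭T′ → ⟦⟧-cong (f? T) (f? T′) (f-resp T↭T′) (f-resp (↭-sym T↭T′)))
           (λ T x∉T → ⟦⟧-no (f? T) λ { (_ , x∈T ∷ _) → x∉T x∈T })
           (λ T x∈T → ⟦⟧-no (f? (x ∷ T)) λ { ((_ , x~T ∷ _) , _) → R-irrefl (All.lookup x~T x∈T) }) ⟩
    ∑ (f ∘ (x ∷_)) (subsets X)
      ≡⟨ ∑-subsets-filter (R? x) (f ∘ (x ∷_))
           (λ T x≁T → ⟦⟧-no (f? (x ∷ T)) λ { ((_ , x~T ∷ _) , _) → x≁T x~T }) X ⟩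
    ∑ (f ∘ (x ∷_)) (subsets (filter (R? x) X))
      ≡⟨ ∑-cong-∈ (subsets (filter (R? x) X)) (λ {T} T∈ →
           ⟦⟧-cong (f? (x ∷ T)) (independent? R? n T ×-dec all? (_∈ᴬ? T) S)
             (λ { ((len , _ ∷ T~) , _ ∷ S⊆xT) →
                  (suc-injective len , T~) , All.zipWith (λ (x~y , y∈) → drop-x x~y y∈) (x~S , S⊆xT) })
             (λ ((len , T~) , S⊆T) →
                (cong suc len , All.tabulate (λ y∈ → proj₂ (∈-filter⁻ (R? x) {xs = X} (∈-subsets⇒⊆ _ T∈ y∈))) ∷ T~) ,
                here refl ∷ All.map there S⊆T)) ⟩
    #extensions n S (filter (R? x) X) ∎
    where
    open ≡-Reasoning
    f? : ∀ T → Dec (Independent R (suc n) T × All (_∈ T) (x ∷ S))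
    f? T = independent? R? (suc n) T ×-dec all? (_∈ᴬ? T) (x ∷ S)
    f : List A → ℕ
    f T = ⟦ f? T ⟧
    f-resp : ∀ {T T′} → T ↭ T′ → Independent R (suc n) T × All (_∈ T) (x ∷ S) →
           Independent R (suc n) T′ × All (_∈ T′) (x ∷ S)
    f-resp T↭T′ ((len , T~) , S⊆T) =
      (trans (sym (Perm.↭-length T↭T′)) len ,
       AllPairs-resp-↭ R-sym (subst (R _) , subst (λ y → R y _)) (↭⇒↭ₛ T↭T′) T~) ,
      All.map (Perm.∈-resp-↭ T↭T′) S⊆T
    drop-x : ∀ {y T} → R x y → y ∈ x ∷ T → y ∈ T
    drop-x x~x (here refl) = contradiction x~x R-irrefl
    drop-x _   (there y∈)  = y∈

-- Recovering a distribution from its binomial moments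

∑-split-max : (g : ℕ → ℕ) {n : ℕ} {xs : List ℕ} → All (_< suc n) xs →
              ∑ g xs ≡ ∑ (λ x → ⟦ x ≟ n ⟧) xs * g n + ∑ g (filter (_<? n) xs)
∑-split-max g {n} {[]} []                 = refl
∑-split-max g {n} {x ∷ xs} (x<1+n ∷ xs<) with m<1+n⇒m<n∨m≡n x<1+n
... | inj₁ x<n rewrite ⟦⟧-no (x ≟ n) (<⇒≢ x<n) | filter-accept (_<? n) {xs = xs} x<n = begin
  g x + ∑ g xs                                           ≡⟨ cong (g x +_) (∑-split-max g xs<) ⟩
  g x + (#n * g n + ∑ g (filter (_<? n) xs))             ≡⟨ x∙yz≈y∙xz (g x) (#n * g n) _ ⟩
  #n * g n + (g x + ∑ g (filter (_<? n) xs)) ∎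
  where
  open ≡-Reasoning
  #n = ∑ (λ x → ⟦ x ≟ n ⟧) xs
... | inj₂ refl rewrite ⟦⟧-yes (x ≟ n) refl | filter-reject (_<? n) {xs = xs} (<-irrefl {x} refl) =
  trans (cong (g x +_) (∑-split-max g xs<)) (sym (+-assoc (g x) _ _))

-- For `x < n` the coefficient `x C n` is 0, and for `x ≡ n` it is 1. This is the triangularity of
-- the system of moments.
∑-C-max : ∀ {n xs} → All (_< suc n) xs → ∑ (_C n) xs ≡ ∑ (λ x → ⟦ x ≟ n ⟧) xs
∑-C-max {n} {xs} xs< = ∑-cong-∈ xs λ {x} x∈ → aux x (m<1+n⇒m<n∨m≡n (All.lookup xs< x∈))
  where
  aux : ∀ x → x < n ⊎ x ≡ n → x C n ≡ ⟦ x ≟ n ⟧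
  aux x (inj₁ x<n)  = trans (k>n⇒nCk≡0 x<n) (sym (⟦⟧-no (x ≟ n) (<⇒≢ x<n)))
  aux x (inj₂ refl) = trans (nCn≡1 x) (sym (⟦⟧-yes (x ≟ x) refl))

-- The multiplicity of the largest value is the top moment; remove that value and recurse.
binomial-moments-determine : ∀ n {xs ys} → All (_< n) xs → All (_< n) ys →
  (∀ k → k < n → ∑ (_C k) xs ≡ ∑ (_C k) ys) →
  ∀ k → k < n → ∑ (λ x → ⟦ x ≟ k ⟧) xs ≡ ∑ (λ x → ⟦ x ≟ k ⟧) ys
binomial-moments-determine (suc n) {xs} {ys} xs< ys< eq k k<1+n with m<1+n⇒m<n∨m≡n k<1+n
... | inj₂ refl = trans (sym (∑-C-max xs<)) (trans (eq n k<1+n) (∑-C-max ys<))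
... | inj₁ k<n  = begin
  ∑ (λ x → ⟦ x ≟ k ⟧) xs                       ≡⟨ below xs< ⟩
  ∑ (λ x → ⟦ x ≟ k ⟧) (filter (_<? n) xs)
    ≡⟨ binomial-moments-determine n (All.all-filter (_<? n) xs) (All.all-filter (_<? n) ys) eq-below k k<n ⟩
  ∑ (λ x → ⟦ x ≟ k ⟧) (filter (_<? n) ys)      ≡⟨ below ys< ⟨
  ∑ (λ x → ⟦ x ≟ k ⟧) ys ∎
  where
  open ≡-Reasoning
  #n : List ℕ → ℕ
  #n = ∑ (λ x → ⟦ x ≟ n ⟧)
  below : ∀ {zs} → All (_< suc n) zs →
          ∑ (λ x → ⟦ x ≟ k ⟧) zs ≡ ∑ (λ x → ⟦ x ≟ k ⟧) (filter (_<? n) zs)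
  below {zs} zs< = trans (∑-split-max (λ x → ⟦ x ≟ k ⟧) zs<)
    (cong (_+ ∑ (λ x → ⟦ x ≟ k ⟧) (filter (_<? n) zs))
      (trans (cong (#n zs *_) (⟦⟧-no (n ≟ k) (>⇒≢ k<n))) (*-zeroʳ (#n zs))))
  #n-eq : #n xs ≡ #n ys
  #n-eq = trans (sym (∑-C-max xs<)) (trans (eq n ≤-refl) (∑-C-max ys<))
  eq-below : ∀ j → j < n → ∑ (_C j) (filter (_<? n) xs) ≡ ∑ (_C j) (filter (_<? n) ys)
  -- The value `n` occurs equally often on both sides, so its share of every moment cancels.
  eq-below j j<n = +-cancelˡ-≡ (#n ys * (n C j)) _ _ (begin
    #n ys * (n C j) + ∑ (_C j) (filter (_<? n) xs) ≡⟨ cong (λ c → c * (n C j) + _) #n-eq ⟨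
    #n xs * (n C j) + ∑ (_C j) (filter (_<? n) xs) ≡⟨ ∑-split-max (_C j) xs< ⟨
    ∑ (_C j) xs                                    ≡⟨ eq j (m<n⇒m<1+n j<n) ⟩
    ∑ (_C j) ys                                    ≡⟨ ∑-split-max (_C j) ys< ⟩
    #n ys * (n C j) + ∑ (_C j) (filter (_<? n) ys) ∎)

-- Duplicate-free lists and filtered products

unique-⊆⊇⇒length : {xs ys : List A} → Unique xs → Unique ys → xs ⊆ ys → ys ⊆ xs → length xs ≡ length ys
unique-⊆⊇⇒length xs! ys! xs⊆ys ys⊆xs =
  Perm.↭-length (∼bag⇒↭ (unique∧set⇒bag xs! ys! (mk⇔ xs⊆ys ys⊆xs)))

unique-lookup-injective : {xs : List A} → Unique xs → ∀ {i j} → lookup xs i ≡ lookup xs j → i ≡ j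
unique-lookup-injective {xs = x ∷ xs} (x≢ ∷ xs!) {zero}  {zero}  eq = refl
unique-lookup-injective {xs = x ∷ xs} (x≢ ∷ xs!) {zero}  {suc j} eq =
  contradiction eq (All.lookup x≢ (∈-lookup j))
unique-lookup-injective {xs = x ∷ xs} (x≢ ∷ xs!) {suc i} {zero}  eq =
  contradiction (sym eq) (All.lookup x≢ (∈-lookup i))
unique-lookup-injective {xs = x ∷ xs} (x≢ ∷ xs!) {suc i} {suc j} eq =
  cong suc (unique-lookup-injective xs! eq)

length-filter-≢ : (_≟ᴬ_ : DecidableEquality A) {x : A} {xs : List A} → Unique xs → x ∈ xs →
                  suc (length (filter (λ y → ¬? (x ≟ᴬ y)) xs)) ≡ length xs
length-filter-≢ _≟ᴬ_ {x} {y ∷ xs} (y≢ ∷ xs!) (here refl)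
  rewrite filter-reject (λ z → ¬? (x ≟ᴬ z)) {x} {xs} (λ x≢x → x≢x refl) =
  cong (suc ∘ length) (filter-all (λ z → ¬? (x ≟ᴬ z)) y≢)
length-filter-≢ _≟ᴬ_ {x} {y ∷ xs} (y≢ ∷ xs!) (there x∈)
  rewrite filter-accept (λ z → ¬? (x ≟ᴬ z)) {y} {xs} (All.lookup y≢ x∈ ∘ sym) =
  cong suc (length-filter-≢ _≟ᴬ_ xs! x∈)

filter-map : {P : B → Set} (P? : Decidable P) (f : A → B) (xs : List A) →
             filter P? (map f xs) ≡ map f (filter (P? ∘ f) xs)
filter-map P? f []       = refl
filter-map P? f (x ∷ xs) with does (P? (f x))
... | true  = cong (f x ∷_) (filter-map P? f xs)
... | false = filter-map P? f xs

-- This is why the cells that a rook does not attack form a grid again.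
filter-cartesianProductWith :
  {P : D → Set} {Q : A → Set} {T : B → Set}
  (P? : Decidable P) (Q? : Decidable Q) (T? : Decidable T) (f : A → B → D) →
  (∀ x y → P (f x y) → Q x × T y) → (∀ x y → Q x → T y → P (f x y)) → ∀ xs ys →
  filter P? (cartesianProductWith f xs ys) ≡ cartesianProductWith f (filter Q? xs) (filter T? ys)
filter-cartesianProductWith P? Q? T? f to from []       ys = refl
filter-cartesianProductWith P? Q? T? f to from (x ∷ xs) ys
  rewrite filter-++ P? (map (f x) ys) (cartesianProductWith f xs ys) | filter-map P? (f x) ys
        | filter-cartesianProductWith P? Q? T? f to from xs ys with Q? x
... | yes q = cong (λ zs → map (f x) zs ++ _)
                   (filter-≐ (P? ∘ f x) T? (proj₂ ∘ to x _ , from x _ q) ys)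
... | no ¬q = cong (λ zs → map (f x) zs ++ _)
                   (filter-none (P? ∘ f x) (All.universal (λ y → ¬q ∘ proj₁ ∘ to x y) ys))

cartesianProductWith-map : ∀ {A′ B′ : Set} (f : A → B → D) (g : A′ → A) (h : B′ → B) xs ys →
  cartesianProductWith f (map g xs) (map h ys) ≡ map (λ (x , y) → f (g x) (h y)) (cartesianProduct xs ys)
cartesianProductWith-map f g h []       ys = refl
cartesianProductWith-map f g h (x ∷ xs) ys = begin
  map (f (g x)) (map h ys) ++ cartesianProductWith f (map g xs) (map h ys)
    ≡⟨ cong₂ _++_ (trans (sym (map-∘ ys)) (map-∘ ys)) (cartesianProductWith-map f g h xs ys) ⟩
  map (λ (x , y) → f (g x) (h y)) (map (x ,_) ys) ++ map (λ (x , y) → f (g x) (h y)) (cartesianProduct xs ys)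
    ≡⟨ map-++ (λ (x , y) → f (g x) (h y)) (map (x ,_) ys) (cartesianProduct xs ys) ⟨
  map (λ (x , y) → f (g x) (h y)) (cartesianProduct (x ∷ xs) ys) ∎
  where open ≡-Reasoning

map-lookup-allFin : (xs : List A) → map (lookup xs) (allFin (length xs)) ≡ xs
map-lookup-allFin xs = trans (map-tabulate id (lookup xs)) (tabulate-lookup xs)

-- Independent sets as transversals

-- Two elements of one fibre are never related, so at most one of them can be chosen. On the square
-- the fibres are the columns.
independent-fiber : {R : Rel A 0ℓ} (g : B → A) → (∀ t t′ → ¬ R (g t) (g t′)) →
  ∀ ts ys {P} → P ∈ subsets (map g ts ++ ys) → AllPairs R P →
  P ∈ subsets ys ⊎ (∃[ t ] ∃[ P′ ] (P ≡ g t ∷ P′ × P′ ∈ subsets ys))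
independent-fiber g g≁ []       ys P∈ P~ = inj₁ P∈
independent-fiber g g≁ (t ∷ ts) ys P∈ P~ with ∈-++⁻ (map (g t ∷_) (subsets (map g ts ++ ys))) P∈
... | inj₂ P∈′ = independent-fiber g g≁ ts ys P∈′ P~
... | inj₁ P∈′ with ∈-map⁻ (g t ∷_) P∈′ | P~
...   | P′ , P′∈ , refl | t~P′ ∷ P′~ with independent-fiber g g≁ ts ys P′∈ P′~
...     | inj₁ P′∈ys               = inj₂ (t , P′ , refl , P′∈ys)
...     | inj₂ (t′ , _ , refl , _) = contradiction (All.head t~P′) (g≁ t t′)

-- With at most one element per fibre, a set of maximal size must meet every fibre, and it lists its
-- elements in the order of `xs`. A skipped fibre already makes maximal size impossible.
independent-transversal : {R : Rel D 0ℓ} (f : A → B → D) → (∀ x t t′ → ¬ R (f x t) (f x t′)) →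
  ∀ xs ts {P} → P ∈ subsets (cartesianProductWith f xs ts) → AllPairs R P →
  length P ≤ length xs × (length P ≡ length xs → Pointwise (λ x p → ∃[ t ] p ≡ f x t) xs P)
independent-transversal f f≁ []       ts (here refl) P~ = z≤n , λ _ → []
independent-transversal f f≁ (x ∷ xs) ts P∈ P~
  with independent-fiber (f x) (f≁ x) ts (cartesianProductWith f xs ts) P∈ P~
... | inj₁ P∈′ = let len≤ , _ = independent-transversal f f≁ xs ts P∈′ P~ in
  m≤n⇒m≤1+n len≤ , λ len≡ → contradiction (≤-reflexive (sym len≡)) (≤⇒≯ len≤)
... | inj₂ (t , P′ , refl , P′∈) =
  let len≤ , full = independent-transversal f f≁ xs ts P′∈ (AllPairs.tail P~) in
  s≤s len≤ , λ len≡ → (t , refl) ∷ full (suc-injective len≡)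

Pointwise-tabulate : {f : A → B → D} → ∀ {n} (g : Fin n → A) {P} →
  Pointwise (λ x p → ∃[ t ] p ≡ f x t) (tabulate g) P →
  Σ[ t ∈ (Fin n → B) ] P ≡ tabulate (λ i → f (g i) (t i))
Pointwise-tabulate {n = zero}  g []               = (λ ()) , refl
Pointwise-tabulate {n = suc n} g ((t , refl) ∷ ps) with Pointwise-tabulate (g ∘ suc) ps
... | ts , refl = (λ { zero → t ; (suc i) → ts i }) , refl

∈-subsets-++ʳ : (ys : List A) {zs P : List A} → P ∈ subsets zs → P ∈ subsets (ys ++ zs)
∈-subsets-++ʳ []       P∈ = P∈
∈-subsets-++ʳ (y ∷ ys) P∈ = ∈-++⁺ʳ _ (∈-subsets-++ʳ ys P∈)

∈-subsets-∷ : {y : A} {ys zs P : List A} → y ∈ ys → P ∈ subsets zs → y ∷ P ∈ subsets (ys ++ zs)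
∈-subsets-∷ {ys = y ∷ ys} (here refl) P∈ = ∈-++⁺ˡ (∈-map⁺ (y ∷_) (∈-subsets-++ʳ ys P∈))
∈-subsets-∷ {ys = y ∷ ys} (there y∈)  P∈ = ∈-++⁺ʳ _ (∈-subsets-∷ y∈ P∈)

-- A converse to `independent-transversal`: choosing along `xs` respects the order of the product,
-- so the choice is literally one of its sublists.
∈-subsets-cartesianProductWith : (f : A → B → D) (t : A → B) {ts : List B} → (∀ x → t x ∈ ts) →
  ∀ xs → map (λ x → f x (t x)) xs ∈ subsets (cartesianProductWith f xs ts)
∈-subsets-cartesianProductWith f t t∈ []       = here refl
∈-subsets-cartesianProductWith f t t∈ (x ∷ xs) =
  ∈-subsets-∷ (∈-map⁺ (f x) (t∈ x)) (∈-subsets-cartesianProductWith f t t∈ xs)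

-- Injections of a finite set into itself

opposite-injective : ∀ {n} {i j : Fin n} → opposite i ≡ opposite j → i ≡ j
opposite-injective {i = i} {j} eq =
  trans (sym (Finₚ.opposite-involutive i)) (trans (cong opposite eq) (Finₚ.opposite-involutive j))

-- Pigeonhole: if `y` were missed, punching it out would inject `suc n` elements into `n`.
injective⇒surjective : ∀ {n} (f : Fin n → Fin n) → (∀ {i j} → f i ≡ f j → i ≡ j) →
                       ∀ y → ∃[ x ] f x ≡ y
injective⇒surjective {suc n} f f-inj y with Finₚ.any? (λ x → f x Finₚ.≟ y)
... | yes hit = hit
... | no miss = contradiction
  (Finₚ.injective⇒≤ {f = λ x → punchOut {i = y} {j = f x} (λ y≡fx → miss (x , sym y≡fx))}
    (f-inj ∘ Finₚ.punchOut-injective {i = y} _ _))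
  1+n≰n

injective⇒permutation : ∀ {n} (f : Fin n → Fin n) → (∀ {i j} → f i ≡ f j → i ≡ j) →
                        ∃[ σ ] (∀ i → σ ⟨$⟩ʳ i ≡ f i)
injective⇒permutation f f-inj =
  permutation f (proj₁ ∘ f-surj) (proj₂ ∘ f-surj) (λ x → f-inj (proj₂ (f-surj (f x)))) , λ _ → refl
  where f-surj = injective⇒surjective f f-inj

-- Matching two enumerations of equal length

-- The membership proof supplies the position. When `xs` has no duplicates the position, and hence
-- the value, depends on `x` alone.
transfer : (xs ys : List A) → length xs ≡ length ys → ∀ {x} → x ∈ xs → A
transfer xs ys len x∈ = lookup ys (cast len (index x∈))

module _ (xs ys : List A) (len : length xs ≡ length ys) where

  transfer-∈ : ∀ {x} (x∈ : x ∈ xs) → transfer xs ys len x∈ ∈ ys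
  transfer-∈ x∈ = ∈-lookup (cast len (index x∈))

  transfer-cong : Unique xs → ∀ {x x′} (x∈ : x ∈ xs) (x′∈ : x′ ∈ xs) → x ≡ x′ →
                  transfer xs ys len x∈ ≡ transfer xs ys len x′∈
  transfer-cong xs! x∈ x′∈ eq = cong (lookup ys ∘ cast len)
    (unique-lookup-injective xs! (trans (sym (lookup-index x∈)) (trans eq (lookup-index x′∈))))

  transfer-injective : Unique ys → ∀ {x x′} (x∈ : x ∈ xs) (x′∈ : x′ ∈ xs) →
                       transfer xs ys len x∈ ≡ transfer xs ys len x′∈ → x ≡ x′
  transfer-injective ys! x∈ x′∈ eq = trans (lookup-index x∈) (trans
    (cong (lookup xs) (trans (sym (Finₚ.cast-involutive (sym len) len (index x∈))) (trans
      (cong (cast (sym len)) (unique-lookup-injective ys! eq))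
      (Finₚ.cast-involutive (sym len) len (index x′∈)))))
    (sym (lookup-index x′∈)))

  -- The hypothesis is an equation on `x` because surjectivity between setoids speaks of every
  -- element equal to the chosen preimage.
  transfer-inverse : Unique xs → ∀ {x y} (y∈ : y ∈ ys) (x∈ : x ∈ xs) →
                     x ≡ transfer ys xs (sym len) y∈ → transfer xs ys len x∈ ≡ y
  transfer-inverse xs! y∈ x∈ eq = trans
    (cong (lookup ys) (trans
      (cong (cast len) (unique-lookup-injective xs! (trans (sym (lookup-index x∈)) eq)))
      (Finₚ.cast-involutive len (sym len) (index y∈))))
    (sym (lookup-index y∈))

-- Cells of a board and the non-attacking relation

∈-cells⁻ : ∀ B {c} → c ∈ cells B →
           ∃[ i ] ∃[ j ] (j < FerrersBoard.b B i × c ≡ (suc (toℕ i) , suc j))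
∈-cells⁻ B c∈ =
  let i , c∈i = satisfied (∈-concatMap⁻ (λ i → map (λ j → suc (toℕ i) , suc j) (upTo (FerrersBoard.b B i)))
                                        {xs = allFin (FerrersBoard.n B)} c∈)
      j , j∈ , c≡ = ∈-map⁻ _ c∈i
  in i , j , ∈-upTo⁻ j∈ , c≡

cells-unique : ∀ B → Unique (cells B)
cells-unique B = Unique.concat⁺
  (All.map⁺ (All.universal (λ i → Unique.map⁺ (suc-injective ∘ cong row) (Unique.upTo⁺ (b i))) (allFin n)))
  (AllPairs.map⁺ (AllPairs.map (λ i≢j {_} (c∈i , c∈j) → i≢j (same-column c∈i c∈j)) (Unique.allFin⁺ n)))
  where
  open FerrersBoard B
  same-column : ∀ {i j : Fin n} {c hᵢ hⱼ} → c ∈ map (λ r → suc (toℕ i) , suc r) (upTo hᵢ) →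
                c ∈ map (λ r → suc (toℕ j) , suc r) (upTo hⱼ) → i ≡ j
  same-column c∈i c∈j with ∈-map⁻ _ c∈i | ∈-map⁻ _ c∈j
  ... | _ , _ , refl | _ , _ , eq = Finₚ.toℕ-injective (suc-injective (cong column eq))

nonAttacking? : (m : ℕ) .{{_ : NonZero m}} → Decidable₂ (NonAttacking m)
nonAttacking? m c d = ¬? (column c ≟ column d) ×-dec ¬? (level m c ≟ level m d)

NonAttacking-sym : (m : ℕ) .{{_ : NonZero m}} → Symmetric (NonAttacking m)
NonAttacking-sym m (c≢ , l≢) = c≢ ∘ sym , l≢ ∘ sym

NonAttacking-irrefl : (m : ℕ) .{{_ : NonZero m}} → ∀ {c} → ¬ NonAttacking m c c
NonAttacking-irrefl m (c≢c , _) = c≢c refl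

-- Column, level and position within the level.
Coordinates : ℕ → ℕ → ℕ → Set
Coordinates a b m = Fin a × Fin b × Fin m

Separated : ∀ {a b m} → Rel (Coordinates a b m) 0ℓ
Separated (i , l , _) (j , l′ , _) = i ≢ j × l ≢ l′

separated? : ∀ {a b m} → Decidable₂ (Separated {a} {b} {m})
separated? (i , l , _) (j , l′ , _) = ¬? (i Finₚ.≟ j) ×-dec ¬? (l Finₚ.≟ l′)

-- For `a = b = n` the value is `n! * m ^ n`; what the proof uses is that it depends on the sizes
-- alone.
#grid : (a b m n : ℕ) → ℕ
#grid a b m n =
  #independent separated? n (cartesianProduct (allFin a) (cartesianProduct (allFin b) (allFin m)))

-- Grids of columns and levels inside the square

module Grid (m : ℕ) .{{_ : NonZero m}} (N : ℕ) where

  open Extensions _≟ᶜ_ (nonAttacking? m) (λ {c} {d} → NonAttacking-sym m {c} {d}) (λ {c} → NonAttacking-irrefl m {c}) public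

  cell : Fin N → Fin N × Fin m → Cell
  cell i (l , s) = suc (toℕ i) , toℕ l * m + suc (toℕ s)

  -- Columns form the outer factor, so with increasing lists the cells come in lexicographic order.
  grid : List (Fin N) → List (Fin N) → List Cell
  grid I L = cartesianProductWith cell I (cartesianProduct L (allFin m))

  level-cell : ∀ i l s → level m (cell i (l , s)) ≡ suc (toℕ l)
  level-cell i l s = cong suc (begin
    (toℕ l * m + suc (toℕ s) ∸ 1) / m ≡⟨ cong (λ r → (r ∸ 1) / m) (+-suc (toℕ l * m) (toℕ s)) ⟩
    (toℕ l * m + toℕ s) / m           ≡⟨ +-distrib-/-∣ˡ (toℕ s) (n∣m*n (toℕ l)) ⟩
    toℕ l * m / m + toℕ s / m         ≡⟨ cong₂ _+_ (m*n/n≡m (toℕ l) m) (m<n⇒m/n≡0 (Finₚ.toℕ<n s)) ⟩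
    toℕ l + 0                         ≡⟨ +-identityʳ (toℕ l) ⟩
    toℕ l ∎)
    where open ≡-Reasoning

  level-cell-injective : ∀ {i j l l′ s s′} →
                         level m (cell i (l , s)) ≡ level m (cell j (l′ , s′)) → l ≡ l′
  level-cell-injective {i} {j} {l} {l′} {s} {s′} eq = Finₚ.toℕ-injective (suc-injective
    (trans (sym (level-cell i l s)) (trans eq (level-cell j l′ s′))))

  column-cell-injective : ∀ {i j t t′} → column (cell i t) ≡ column (cell j t′) → i ≡ j
  column-cell-injective = Finₚ.toℕ-injective ∘ suc-injective

  cell-injective : ∀ {i j t t′} → cell i t ≡ cell j t′ → i ≡ j × t ≡ t′
  cell-injective {i} {j} {l , s} {l′ , s′} eq
    with column-cell-injective {i} {j} {l , s} {l′ , s′} (cong column eq)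
       | level-cell-injective {i} {j} {l} {l′} {s} {s′} (cong (level m) eq)
  ... | refl | refl = refl , cong (l ,_)
    (Finₚ.toℕ-injective (suc-injective (+-cancelˡ-≡ (toℕ l * m) _ _ (cong row eq))))

  NonAttacking⇒≢ : ∀ {i j l l′ s s′} → NonAttacking m (cell i (l , s)) (cell j (l′ , s′)) → i ≢ j × l ≢ l′
  NonAttacking⇒≢ {i} {j} {l} {l′} {s} {s′} (c≢ , l≢) =
    c≢ ∘ cong (suc ∘ toℕ) ,
    λ { refl → l≢ (trans (level-cell i l s) (sym (level-cell j l s′))) }

  ≢⇒NonAttacking : ∀ {i j l l′ s s′} → i ≢ j → l ≢ l′ → NonAttacking m (cell i (l , s)) (cell j (l′ , s′))
  ≢⇒NonAttacking {i} {j} {l} {l′} {s} {s′} i≢ l≢ =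
    i≢ ∘ column-cell-injective {i} {j} {l , s} {l′ , s′} ,
    l≢ ∘ level-cell-injective {i} {j} {l} {l′} {s} {s′}

  grid-unique : ∀ {I L} → Unique I → Unique L → Unique (grid I L)
  grid-unique I! L! = Unique.cartesianProductWith⁺ cell cell-injective I!
    (Unique.cartesianProduct⁺ L! (Unique.allFin⁺ m))

  -- A rook attacks its whole column and its whole level, whatever its position `s` in that level.
  filter-grid : ∀ i l s I L → filter (nonAttacking? m (cell i (l , s))) (grid I L) ≡
                grid (filter (λ j → ¬? (i Finₚ.≟ j)) I) (filter (λ l′ → ¬? (l Finₚ.≟ l′)) L)
  filter-grid i l s I L = trans
    (filter-cartesianProductWith (nonAttacking? m (cell i (l , s)))
       (λ j → ¬? (i Finₚ.≟ j)) (λ t → ¬? (l Finₚ.≟ proj₁ t)) cell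
       (λ j t → NonAttacking⇒≢ {i} {j} {l} {proj₁ t} {s} {proj₂ t})
       (λ j t → ≢⇒NonAttacking {i} {j} {l} {proj₁ t} {s} {proj₂ t}) I (cartesianProduct L (allFin m)))
    (cong (cartesianProductWith cell (filter (λ j → ¬? (i Finₚ.≟ j)) I)) (trans
      (filter-cartesianProductWith (λ t → ¬? (l Finₚ.≟ proj₁ t)) (λ l′ → ¬? (l Finₚ.≟ l′))
         -- All `m` positions of a surviving level remain, hence the trivially true condition on
         -- `allFin m`.
         (λ _ → yes tt) _,_ (λ _ _ l≢ → l≢ , tt) (λ _ _ l≢ _ → l≢) L (allFin m))
      (cong (cartesianProduct (filter (λ l′ → ¬? (l Finₚ.≟ l′)) L))
        (filter-all (λ _ → yes tt) (All.universal (λ _ → tt) (allFin m))))))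

  -- Attacks depend only on equality of columns and of levels, so the entries of `I` and `L` may be
  -- replaced by their positions in these lists.
  #independent-grid : ∀ {I L} → Unique I → Unique L → ∀ n →
    #independent (nonAttacking? m) n (grid I L) ≡ #grid (length I) (length L) m n
  #independent-grid {I} {L} I! L! n = trans
    (cong (#independent (nonAttacking? m) n) grid≡map)
    (#independent-map separated? (nonAttacking? m) f coords
      (λ { {i , l , s} {j , l′ , s′} _ _ (i≢j , l≢l′) →
           ≢⇒NonAttacking (i≢j ∘ unique-lookup-injective I!) (l≢l′ ∘ unique-lookup-injective L!) })
      (λ { {i , l , s} {j , l′ , s′} _ _ na → let c≢ , l≢ = NonAttacking⇒≢ {s = s} {s′ = s′} na in
           c≢ ∘ cong (lookup I) , l≢ ∘ cong (lookup L) })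
      n)
    where
    open ≡-Reasoning
    coords = cartesianProduct (allFin (length I)) (cartesianProduct (allFin (length L)) (allFin m))
    f : Coordinates (length I) (length L) m → Cell
    f (i , l , s) = cell (lookup I i) (lookup L l , s)
    grid≡map : grid I L ≡ map f coords
    grid≡map = begin
      grid I L
        ≡⟨ cong₂ grid (map-lookup-allFin I) (map-lookup-allFin L) ⟨
      cartesianProductWith cell I′ (cartesianProduct L′ (allFin m))
        ≡⟨ cong (λ ss → cartesianProductWith cell I′ (cartesianProduct L′ ss)) (map-id (allFin m)) ⟨
      cartesianProductWith cell I′ (cartesianProduct L′ (map id (allFin m)))
        ≡⟨ cong (cartesianProductWith cell I′)
             (cartesianProductWith-map _,_ (lookup L) id (allFin (length L)) (allFin m)) ⟩
      cartesianProductWith cell I′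
        (map (λ (l , s) → lookup L l , s) (cartesianProduct (allFin (length L)) (allFin m)))
        ≡⟨ cartesianProductWith-map cell (lookup I) (λ (l , s) → lookup L l , s)
             (allFin (length I)) (cartesianProduct (allFin (length L)) (allFin m)) ⟩
      map f coords ∎
      where
      I′ = map (lookup I) (allFin (length I))
      L′ = map (lookup L) (allFin (length L))

  -- Each rook of `S` uses up one column, one level and one of the rooks to be placed, which keeps
  -- both length equations true. With `S` exhausted, `n` rooks remain for `n` columns and `n`
  -- levels.
  #extensions-grid : ∀ n S {I L} → Unique I → Unique L →
    length I ≡ length S + n → length L ≡ length S + n → S ⊆ grid I L → AllPairs (NonAttacking m) S →
    #extensions (length S + n) S (grid I L) ≡ #grid n n m n
  #extensions-grid n [] {I} {L} I! L! #I #L S⊆ S~ = begin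
    #extensions n [] (grid I L)                 ≡⟨ #extensions-[] n (grid I L) ⟩
    #independent (nonAttacking? m) n (grid I L) ≡⟨ #independent-grid I! L! n ⟩
    #grid (length I) (length L) m n             ≡⟨ cong₂ (λ a b → #grid a b m n) #I #L ⟩
    #grid n n m n ∎
    where open ≡-Reasoning
  #extensions-grid n (x ∷ S) {I} {L} I! L! #I #L S⊆ (x~S ∷ S~)
    with ∈-cartesianProductWith⁻ cell I (cartesianProduct L (allFin m)) (S⊆ (here refl))
  ... | i , (l , s) , i∈ , t∈ , refl = begin
    #extensions (suc (length S + n)) (x ∷ S) (grid I L)
      ≡⟨ #extensions-∷ (grid-unique I! L!) (S⊆ (here refl)) x~S ⟩
    #extensions (length S + n) S (filter (nonAttacking? m x) (grid I L))
      ≡⟨ cong (#extensions (length S + n) S) (filter-grid i l s I L) ⟩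
    #extensions (length S + n) S (grid I′ L′)
      ≡⟨ #extensions-grid n S (Unique.filter⁺ _ I!) (Unique.filter⁺ _ L!)
           (suc-injective (trans (length-filter-≢ Finₚ._≟_ I! i∈) #I))
           (suc-injective (trans (length-filter-≢ Finₚ._≟_ L! (proj₁ (∈-cartesianProduct⁻ L (allFin m) t∈))) #L))
           -- The later rooks of `S` are not attacked by `x`, so they lie in the reduced grid.
           (λ y∈ → subst (_ ∈_) (filter-grid i l s I L)
             (∈-filter⁺ (nonAttacking? m x) (S⊆ (there y∈)) (All.lookup x~S y∈)))
           S~ ⟩
    #grid n n m n ∎
    where
    open ≡-Reasoning
    I′ = filter (λ j → ¬? (i Finₚ.≟ j)) I
    L′ = filter (λ l′ → ¬? (l Finₚ.≟ l′)) L

  -- Full placements and the moments of their hit counts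

  square : List Cell
  square = grid (allFin N) (allFin N)

  square-unique : Unique square
  square-unique = grid-unique (Unique.allFin⁺ N) (Unique.allFin⁺ N)

  -- Listed as subsets of the square instead of as images of `R`, so that they are free of
  -- duplicates and can be counted by `#extensions`.
  placements : List CellSet
  placements = filter (isPlacement? m N) (subsets square)

  #extensions-placement : ∀ {k S} → k ≤ N → S ⊆ square → IsPlacement m k S →
                          #extensions N S square ≡ #grid (N ∸ k) (N ∸ k) m (N ∸ k)
  #extensions-placement {k} {S} k≤N S⊆ (refl , S~) = begin
    #extensions N S square                    ≡⟨ cong (λ n → #extensions n S square) (m+[n∸m]≡n k≤N) ⟨
    #extensions (length S + (N ∸ k)) S square
      ≡⟨ #extensions-grid (N ∸ k) S (Unique.allFin⁺ N) (Unique.allFin⁺ N) N≡ N≡ S⊆ S~ ⟩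
    #grid (N ∸ k) (N ∸ k) m (N ∸ k) ∎
    where
    open ≡-Reasoning
    N≡ : length (allFin N) ≡ length S + (N ∸ k)
    N≡ = trans (length-tabulate id) (sym (m+[n∸m]≡n k≤N))

  -- Subsets of a placement are non-attacking. `Unique S` ensures that only distinct cells are
  -- compared, since a cell shares its column with itself.
  #extensions-nonplacement : ∀ {S} → Unique S → ¬ AllPairs (NonAttacking m) S → #extensions N S square ≡ 0
  #extensions-nonplacement {S} S! ¬S~ = ∑-zero (subsets square) λ {P} _ →
    ⟦⟧-no (isPlacement? m N P ×-dec all? (_∈? P) S) λ ((_ , P~) , S⊆P) →
      ¬S~ (AllPairs-map-∈ (λ x∈ y∈ → AllPairs-lookup (λ {c} {d} → NonAttacking-sym m {c} {d}) P~
                                       (All.lookup S⊆P x∈) (All.lookup S⊆P y∈)) S!)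

  -- The point is the range of the sum: subsets of `X` do not vary with `P`, so the order of
  -- summation can be exchanged.
  length-∩-C : ∀ {P X} k → Unique P → Unique X →
    length (P ∩ X) C k ≡ ∑ (λ S → ⟦ length S ≟ k ⟧ * ⟦ all? (_∈? P) S ⟧) (subsets X)
  length-∩-C {P} {X} k P! X! = begin
    length (P ∩ X) C k
      -- `P ∩ X` is a sublist of `P`; exchanging the roles makes it a sublist of `X`.
      ≡⟨ cong (_C k) (unique-⊆⊇⇒length (Unique.filter⁺ (_∈? X) P!) (Unique.filter⁺ (_∈? P) X!)
           (∩-swap P X) (∩-swap X P)) ⟩
    length (X ∩ P) C k
      ≡⟨ count-k-subsets k (X ∩ P) ⟨
    ∑ (λ S → ⟦ length S ≟ k ⟧) (subsets (X ∩ P))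
      ≡⟨ ∑-cong-∈ (subsets (X ∩ P)) (λ {S} S∈ → trans (sym (*-identityʳ _))
           (cong (⟦ length S ≟ k ⟧ *_) (sym (⟦⟧-yes (all? (_∈? P) S)
             (All.tabulate λ y∈ → proj₂ (∈-filter⁻ (_∈? P) {xs = X} (∈-subsets⇒⊆ (X ∩ P) S∈ y∈))))))) ⟩
    ∑ f (subsets (X ∩ P))
      ≡⟨ ∑-subsets-filter (_∈? P) f (λ S S⊈P →
           trans (cong (⟦ length S ≟ k ⟧ *_) (⟦⟧-no (all? (_∈? P) S) S⊈P)) (*-zeroʳ ⟦ length S ≟ k ⟧)) X ⟨
    ∑ f (subsets X) ∎
    where
    open ≡-Reasoning
    f : CellSet → ℕ
    f S = ⟦ length S ≟ k ⟧ * ⟦ all? (_∈? P) S ⟧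
    ∩-swap : ∀ Y Z → Y ∩ Z ⊆ Z ∩ Y
    ∩-swap Y Z x∈ = let x∈Y , x∈Z = ∈-filter⁻ (_∈? Z) {xs = Y} x∈ in ∈-filter⁺ (_∈? Y) x∈Z x∈Y

  hit-moments : ∀ {X} → Unique X → X ⊆ square → ∀ k → k ≤ N →
    ∑ (λ P → length (P ∩ X) C k) placements ≡
    #grid (N ∸ k) (N ∸ k) m (N ∸ k) * #independent (nonAttacking? m) k X
  hit-moments {X} X! X⊆ k k≤N = begin
    ∑ (λ P → length (P ∩ X) C k) placements
      ≡⟨ ∑-cong-∈ placements (λ {P} P∈ → length-∩-C k
           (AllPairs-subset square (proj₁ (∈-filter⁻ (isPlacement? m N) P∈)) square-unique) X!) ⟩
    ∑ (λ P → ∑ (λ S → ⟦ length S ≟ k ⟧ * ⟦ all? (_∈? P) S ⟧) (subsets X)) placements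
      ≡⟨ ∑-comm _ placements (subsets X) ⟩
    ∑ (λ S → ∑ (λ P → ⟦ length S ≟ k ⟧ * ⟦ all? (_∈? P) S ⟧) placements) (subsets X)
      ≡⟨ ∑-cong (subsets X) (λ S → ∑-*ˡ ⟦ length S ≟ k ⟧ (λ P → ⟦ all? (_∈? P) S ⟧) placements) ⟩
    ∑ (λ S → ⟦ length S ≟ k ⟧ * ∑ (λ P → ⟦ all? (_∈? P) S ⟧) placements) (subsets X)
      ≡⟨ ∑-cong (subsets X) (λ S → cong (⟦ length S ≟ k ⟧ *_) (trans
           (∑-filter (isPlacement? m N) (λ P → ⟦ all? (_∈? P) S ⟧) (subsets square))
           (∑-cong (subsets square) λ P → sym (⟦⟧-× (isPlacement? m N P) (all? (_∈? P) S))))) ⟩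
    ∑ (λ S → ⟦ length S ≟ k ⟧ * #extensions N S square) (subsets X)
      ≡⟨ ∑-cong-∈ (subsets X) by-subset ⟩
    ∑ (λ S → G * ⟦ isPlacement? m k S ⟧) (subsets X)
      ≡⟨ ∑-*ˡ G (λ S → ⟦ isPlacement? m k S ⟧) (subsets X) ⟩
    G * ∑ (λ S → ⟦ isPlacement? m k S ⟧) (subsets X)
      ≡⟨ cong (G *_) (length-filter≡∑ (isPlacement? m k) (subsets X)) ⟨
    G * #independent (nonAttacking? m) k X ∎
    where
    open ≡-Reasoning
    G = #grid (N ∸ k) (N ∸ k) m (N ∸ k)
    by-subset : ∀ {S} → S ∈ subsets X →
                ⟦ length S ≟ k ⟧ * #extensions N S square ≡ G * ⟦ isPlacement? m k S ⟧
    by-subset {S} S∈ = weigh (length S ≟ k) (allPairs? (nonAttacking? m) S)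
      where
      -- Both decisions are arguments so that the indicators compute in each case.
      weigh : (len? : Dec (length S ≡ k)) (S~? : Dec (AllPairs (NonAttacking m) S)) →
              ⟦ len? ⟧ * #extensions N S square ≡ G * ⟦ len? ×-dec S~? ⟧
      weigh (no _)    _        = sym (*-zeroʳ G)
      weigh (yes len) (yes S~) =
        trans (cong (1 *_) (#extensions-placement k≤N (X⊆ ∘ ∈-subsets⇒⊆ X S∈) (len , S~))) (*-comm 1 G)
      weigh (yes len) (no ¬S~) =
        trans (cong (1 *_) (#extensions-nonplacement (AllPairs-subset X S∈ X!) ¬S~)) (sym (*-zeroʳ G))

  -- Full placements and the wreath product

  -- Level `N + 1 - σ(i)`, with levels and values of `σ` counted from 1, becomes `opposite` of the
  -- value when both are counted from 0.
  R≡cells : (ω@(s , σ) : Wreath m N) → R ω ≡ map (λ i → cell i (opposite (σ ⟨$⟩ʳ i) , s i)) (allFin N)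
  R≡cells (s , σ) = map-cong
    (λ i → cong (λ l → suc (toℕ i) , l * m + suc (toℕ (s i))) (level≡ (σ ⟨$⟩ʳ i))) (allFin N)
    where
    open ≡-Reasoning
    level≡ : ∀ (i : Fin N) → N + 1 ∸ suc (toℕ i) ∸ 1 ≡ toℕ (opposite i)
    level≡ i = begin
      N + 1 ∸ suc (toℕ i) ∸ 1   ≡⟨ cong (λ n → n ∸ suc (toℕ i) ∸ 1) (+-comm N 1) ⟩
      N ∸ toℕ i ∸ 1             ≡⟨ ∸-+-assoc N (toℕ i) 1 ⟩
      N ∸ (toℕ i + 1)           ≡⟨ cong (N ∸_) (+-comm (toℕ i) 1) ⟩
      N ∸ suc (toℕ i)           ≡⟨ Finₚ.opposite-prop i ⟨
      toℕ (opposite i) ∎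

  R∈placements : (ω : Wreath m N) → R ω ∈ placements
  R∈placements ω@(s , σ) rewrite R≡cells ω = ∈-filter⁺ (isPlacement? m N)
    (∈-subsets-cartesianProductWith cell t (λ i → ∈-cartesianProduct⁺ (∈-allFin _) (∈-allFin _)) (allFin N))
    ( trans (length-map (λ i → cell i (t i)) (allFin N)) (length-tabulate id)
    , AllPairs.map⁺ (AllPairs.map (λ {i} {j} i≢j →
        ≢⇒NonAttacking {s = s i} {s′ = s j} i≢j (i≢j ∘ Injection.injective (↔⇒↣ σ) ∘ opposite-injective))
        (Unique.allFin⁺ N)))
    where
    t : Fin N → Fin N × Fin m
    t i = opposite (σ ⟨$⟩ʳ i) , s i

  -- `N` rooks in distinct columns occupy every column, which gives a level and a position for each.
  -- Levels are distinct, so the level map is injective, and following it by `opposite` yields the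
  -- permutation.
  ∈placements⇒R : ∀ {P} → P ∈ placements → ∃[ ω ] P ≡ R {m} {N} ω
  ∈placements⇒R {P} P∈ = ω , trans P≡ (trans (map-cong
      (λ i → cong (λ l → cell i (l , proj₂ (t i)))
        (sym (trans (cong opposite (σ≡ i)) (Finₚ.opposite-involutive (proj₁ (t i))))))
      (allFin N)) (sym (R≡cells ω)))
    where
    P∈subsets = proj₁ (∈-filter⁻ (isPlacement? m N) {xs = subsets square} P∈)
    P-pl      = proj₂ (∈-filter⁻ (isPlacement? m N) {xs = subsets square} P∈)
    transversal = Pointwise-tabulate id (proj₂
      (independent-transversal cell (λ i t t′ → λ (c≢ , _) → c≢ refl) (allFin N) _ P∈subsets (proj₂ P-pl))
      (trans (proj₁ P-pl) (sym (length-tabulate id))))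
    t : Fin N → Fin N × Fin m
    t = proj₁ transversal
    P≡ : P ≡ map (λ i → cell i (t i)) (allFin N)
    P≡ = trans (proj₂ transversal) (sym (map-tabulate id (λ i → cell i (t i))))
    cell∈P : ∀ i → cell i (t i) ∈ P
    cell∈P i = subst (cell i (t i) ∈_) (sym P≡) (∈-map⁺ (λ i → cell i (t i)) (∈-allFin i))
    level-injective : ∀ {i j} → proj₁ (t i) ≡ proj₁ (t j) → i ≡ j
    level-injective {i} {j} eq with i Finₚ.≟ j
    ... | yes i≡j = i≡j
    ... | no  i≢j = contradiction eq (proj₂ (NonAttacking⇒≢ {i} {j} {proj₁ (t i)} {proj₁ (t j)} {proj₂ (t i)} {proj₂ (t j)}
      (AllPairs-lookup (λ {c} {d} → NonAttacking-sym m {c} {d}) (proj₂ P-pl) (cell∈P i) (cell∈P j)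
        (i≢j ∘ proj₁ ∘ cell-injective {i} {j} {t i} {t j}))))
    σ-perm = injective⇒permutation (opposite ∘ proj₁ ∘ t) (level-injective ∘ opposite-injective)
    σ : Permutation′ N
    σ = proj₁ σ-perm
    σ≡ : ∀ i → σ ⟨$⟩ʳ i ≡ opposite (proj₁ (t i))
    σ≡ = proj₂ σ-perm
    ω : Wreath m N
    ω = proj₂ ∘ t , σ

  -- Division of the row index by `m` gives the level as quotient and the position as remainder.
  cells-Sq⊆square : cells (Sq N m) ⊆ square
  cells-Sq⊆square c∈ with ∈-cells⁻ (Sq N m) c∈
  ... | i , j , j<mN , refl = subst (_∈ square) cell≡
    (∈-cartesianProductWith⁺ cell (∈-allFin i) (∈-cartesianProduct⁺ (∈-allFin l) (∈-allFin s)))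
    where
    open ≡-Reasoning
    l<N : j / m < N
    l<N = m<n*o⇒m/o<n (subst (j <_) (*-comm m N) j<mN)
    l : Fin N
    l = fromℕ< l<N
    s : Fin m
    s = fromℕ< (m%n<n j m)
    cell≡ : cell i (l , s) ≡ (suc (toℕ i) , suc j)
    cell≡ = cong (suc (toℕ i) ,_) (begin
      toℕ l * m + suc (toℕ s)     ≡⟨ cong₂ (λ a b → a * m + suc b) (Finₚ.toℕ-fromℕ< l<N) (Finₚ.toℕ-fromℕ< (m%n<n j m)) ⟩
      j / m * m + suc (j % m)     ≡⟨ +-comm (j / m * m) _ ⟩
      suc (j % m + j / m * m)     ≡⟨ cong suc (m≡m%n+[m/n]*n j m) ⟨
      suc j ∎)

  -- A board inside the square and its hits

  module Board (B : FerrersBoard) (fits : FitsInside B N m) where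

    open FerrersBoard B using (n)

    shift : Cell → Cell
    shift (i , j) = (i + N) ∸ n , j

    -- Truncated subtraction can be cancelled only where it does not truncate. Fitting inside the
    -- square puts each shifted cell in a column of number at least 1, so the difference is
    -- positive.
    shift-column-injective : ∀ {c d} → c ∈ cells B → d ∈ cells B →
                             column (shift c) ≡ column (shift d) → column c ≡ column d
    shift-column-injective {c} {d} c∈ d∈ eq =
      +-cancelʳ-≡ N _ _ (∸-cancelʳ-≡ (not-truncated c∈) (not-truncated d∈) eq)
      where
      not-truncated : ∀ {c} → c ∈ cells B → n ≤ column c + N
      not-truncated c∈ with ∈-cells⁻ (Sq N m) (fits (∈-map⁺ shift c∈))
      ... | i , _ , _ , shift≡ = <⇒≤ (m∸n≢0⇒n<m λ column≡0 → 0≢1+n (trans (sym column≡0) (cong column shift≡)))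

    shift-injective : ∀ {c d} → c ∈ cells B → d ∈ cells B → shift c ≡ shift d → c ≡ d
    shift-injective c∈ d∈ eq =
      cong₂ _,_ (shift-column-injective c∈ d∈ (cong column eq)) (cong row eq)

    aligned-unique : Unique (aligned N B)
    aligned-unique = AllPairs.map⁺
      (AllPairs-map-∈ (λ c∈ d∈ c≢d → c≢d ∘ shift-injective c∈ d∈) (cells-unique B))

    aligned⊆square : aligned N B ⊆ square
    aligned⊆square = cells-Sq⊆square ∘ fits

    rookNumber-aligned : ∀ k → #independent (nonAttacking? m) k (aligned N B) ≡ rookNumber m k B
    rookNumber-aligned = #independent-map (nonAttacking? m) (nonAttacking? m) shift (cells B)
      (λ c∈ d∈ (c≢ , l≢) → c≢ ∘ shift-column-injective c∈ d∈ , l≢)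
      (λ c∈ d∈ (c≢ , l≢) → c≢ ∘ cong (λ i → (i + N) ∸ n) , l≢)

    hits : ℕ → List CellSet
    hits k = filter (λ P → length (P ∩ aligned N B) ≟ k) placements

    hits-unique : ∀ k → Unique (hits k)
    hits-unique k = Unique.filter⁺ _ (Unique.filter⁺ _ (subsets-unique square-unique))

    hitCounts : List ℕ
    hitCounts = map (λ P → length (P ∩ aligned N B)) placements

    -- This bound is why the moments of order at most `N` suffice.
    hitCounts≤N : All (_< suc N) hitCounts
    hitCounts≤N = All.map⁺ (All.tabulate λ {P} P∈ → s≤s (≤-trans
      (length-filter (_∈? aligned N B) P)
      (≤-reflexive (proj₁ (proj₂ (∈-filter⁻ (isPlacement? m N) {xs = subsets square} P∈))))))

    hitCounts-moments : ∀ k → k ≤ N →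
      ∑ (_C k) hitCounts ≡ #grid (N ∸ k) (N ∸ k) m (N ∸ k) * rookNumber m k B
    hitCounts-moments k k≤N = begin
      ∑ (_C k) hitCounts                                   ≡⟨ ∑-map (_C k) _ placements ⟩
      ∑ (λ P → length (P ∩ aligned N B) C k) placements    ≡⟨ hit-moments aligned-unique aligned⊆square k k≤N ⟩
      G * #independent (nonAttacking? m) k (aligned N B)   ≡⟨ cong (G *_) (rookNumber-aligned k) ⟩
      G * rookNumber m k B ∎
      where
      open ≡-Reasoning
      G = #grid (N ∸ k) (N ∸ k) m (N ∸ k)

    length-hits : ∀ k → length (hits k) ≡ ∑ (λ v → ⟦ v ≟ k ⟧) hitCounts
    length-hits k = trans (length-filter≡∑ (λ P → length (P ∩ aligned N B) ≟ k) placements)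
                          (sym (∑-map (λ v → ⟦ v ≟ k ⟧) _ placements))

    ∈hits : ∀ {k} (h : Setoid.Carrier (HitSet m N k B)) → proj₁ h ∈ hits k
    ∈hits (_ , ω , refl , len) = ∈-filter⁺ (λ P → length (P ∩ aligned N B) ≟ _) (R∈placements ω) len

    -- Some `ω` has to be produced, but equality in `HitSet` compares only the placements, so the
    -- choice does not affect the element.
    fromHits : ∀ {k P} → P ∈ hits k → Setoid.Carrier (HitSet m N k B)
    fromHits {k} {P} P∈ =
      let P∈placements , len = ∈-filter⁻ (λ P → length (P ∩ aligned N B) ≟ k) {xs = placements} P∈
          ω , P≡R = ∈placements⇒R P∈placements
      in P , ω , P≡R , trans (cong (λ Q → length (Q ∩ aligned N B)) (sym P≡R)) len

  -- Equal sizes and the bijection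

  length-hits≡ : ∀ B B′ (fits : FitsInside B N m) (fits′ : FitsInside B′ N m) → RookEquivalent m B B′ →
                 ∀ k → k ≤ N → length (Board.hits B fits k) ≡ length (Board.hits B′ fits′ k)
  length-hits≡ B B′ fits fits′ equiv k k≤N = begin
    length (X.hits k)                  ≡⟨ X.length-hits k ⟩
    ∑ (λ v → ⟦ v ≟ k ⟧) X.hitCounts
      ≡⟨ binomial-moments-determine (suc N) X.hitCounts≤N X′.hitCounts≤N moments≡ k (s≤s k≤N) ⟩
    ∑ (λ v → ⟦ v ≟ k ⟧) X′.hitCounts   ≡⟨ X′.length-hits k ⟨
    length (X′.hits k) ∎
    where
    open ≡-Reasoning
    module X  = Board B fits
    module X′ = Board B′ fits′
    moments≡ : ∀ j → j < suc N → ∑ (_C j) X.hitCounts ≡ ∑ (_C j) X′.hitCounts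
    moments≡ j (s≤s j≤N) = trans (X.hitCounts-moments j j≤N)
      (trans (cong (#grid (N ∸ j) (N ∸ j) m (N ∸ j) *_) (equiv j)) (sym (X′.hitCounts-moments j j≤N)))

theorem24 : (m : ℕ) .{{_ : NonZero m}} (B B′ : FerrersBoard) →
    RookEquivalent m B B′ →
    (N : ℕ) → FitsInside B N m → FitsInside B′ N m →
    (k : ℕ) → k ≤ N →
    Bijection (HitSet m N k B) (HitSet m N k B′)
theorem24 m B B′ equiv N fits fits′ k k≤N = record
  { to        = λ h → X′.fromHits (transfer-∈ H H′ len≡ (X.∈hits h))
  -- Both setoids compare first components, so the remaining fields are exactly the facts about
  -- `transfer`.
  ; cong      = λ {h} {h′} → transfer-cong H H′ len≡ (X.hits-unique k) (X.∈hits h) (X.∈hits h′)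
  ; bijective =
      (λ {h} {h′} → transfer-injective H H′ len≡ (X′.hits-unique k) (X.∈hits h) (X.∈hits h′)) ,
      (λ h′ → X.fromHits (transfer-∈ H′ H (sym len≡) (X′.∈hits h′)) ,
              λ {h} → transfer-inverse H H′ len≡ (X.hits-unique k) (X′.∈hits h′) (X.∈hits h))
  }
  where
  open Grid m N
  module X  = Board B fits
  module X′ = Board B′ fits′
  H  = X.hits k
  H′ = X′.hits k
  len≡ : length H ≡ length H′
  len≡ = length-hits≡ B B′ fits fits′ equiv k k≤N
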